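{- If $A$ is a constant normal form and $M$ is a term with $A\preceq M$, then $A$ is a direct approximation of $M$, i.e. $A\preceq N$ for every $N$ with $M\to^*N$.
   Context: Types: type expressions $\sigma ::= t \mid \sigma+\sigma \mid \sigma\times\sigma\mid \sigma\to\sigma\mid \mu t.\sigma\mid \mathrm{void}$ (types = closed ones), with types identified when they have the same infinite unfolding (type tree). Terms: typed $\lambda$-terms over typed variables and the constants, for all types $\sigma,\tau,\rho$: $0_{\sigma,\tau}:\sigma\to(\sigma+\tau)$, $1_{\sigma,\tau}:\tau\to(\sigma+\tau)$, $\mathrm{case}_{\sigma,\tau,\rho}:(\sigma+\tau)\to(\sigma\to\rho)\to(\tau\to\rho)\to\rho$, $\mathrm{pcase}_{\sigma,\tau,\rho}:(\sigma+\tau)\to\rho\to\rho\to\rho$, $\mathrm{pair}_{\sigma,\tau}:\sigma\to\tau\to(\sigma\times\tau)$, $\mathrm{fst}:(\sigma\times\tau)\to\sigma$, $\mathrm{snd}:(\sigma\times\tau)\to\tau$, $\Omega_\sigma:\sigma$. Reduction $\to$: $\beta$-reduction $(\lambda x.M)N\to M[x:=N]$ and the rules $\mathrm{case}(0x)yz\to yx$; $\mathrm{case}(1x)yz\to zx$; $\mathrm{fst}(\mathrm{pair}\,x\,y)\to x$; $\mathrm{snd}(\mathrm{pair}\,x\,y)\to y$; $\mathrm{pcase}(0x)yz\to y$; $\mathrm{pcase}(1x)yz\to z$; $\mathrm{pcase}\,x(0y)(0z)\to 0(\mathrm{pcase}\,xyz)$; $\mathrm{pcase}\,x(1y)(1z)\to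 1(\mathrm{pcase}\,xyz)$; $\mathrm{pcase}\,x(\mathrm{pair}\,y_1y_2)(\mathrm{pair}\,z_1z_2)\to\mathrm{pair}(\mathrm{pcase}\,x\,y_1z_1)(\mathrm{pcase}\,x\,y_2z_2)$; $(\mathrm{pcase}\,xyz)w\to\mathrm{pcase}\,x(yw)(zw)$ (for a functional result type), applied in any context ($x,y,z,w,y_i,z_i$ arbitrary terms). $\to^*$ is the reflexive transitive closure. A normal form is a term admitting no reduction step. Prefix order: $\preceq$ is the least relation on terms of equal type with $\Omega\preceq M$, $x\preceq x$ for variables and constants, closed under $\lambda$-abstraction and application. A normal form $A$ is a constant normal form iff $A=\Omega$ or $A=\lambda x_1\ldots x_n.\,y\,A_1\ldots A_m$ with $n,m\ge0$, $y$ a variable or a constant not in $\{\Omega,\mathrm{pcase}\}$, each $A_i$ a constant normal form, and, if $y\in\{\mathrm{fst},\mathrm{snd},\mathrm{case}\}$ and $m\ge1$, then $A_1\neq\Omega$. -}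

module Defs where

open import Data.Nat using (ℕ; zero; suc)
open import Data.Fin using (Fin; zero; suc)
open import Data.Vec using (Vec; _∷_; lookup)
open import Data.Product using (Σ; ∃; _×_; _,_)
open import Data.Unit using (⊤)
open import Relation.Nullary using (¬_)
open import Relation.Binary.PropositionalEquality using (_≡_)
open import Relation.Binary.Construct.Closure.ReflexiveTransitive using (Star)

infixr 30 _⇒_
infixr 32 _⊕_
infixr 34 _⊗_

data TyExp (k : ℕ) : Set where
  tv   : Fin k → TyExp k
  _⊕_  : TyExp k → TyExp k → TyExp k
  _⊗_  : TyExp k → TyExp k → TyExp k
  _⇒_  : TyExp k → TyExp k → TyExp k
  μ    : TyExp (suc k) → TyExp k
  void : TyExp k

Ty : Set
Ty = TyExp 0

extᵗ : ∀ {k l} → (Fin k → Fin l) → Fin (suc k) → Fin (suc l)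
extᵗ ρ zero    = zero
extᵗ ρ (suc i) = suc (ρ i)

renᵗ : ∀ {k l} → (Fin k → Fin l) → TyExp k → TyExp l
renᵗ ρ (tv i)  = tv (ρ i)
renᵗ ρ (a ⊕ b) = renᵗ ρ a ⊕ renᵗ ρ b
renᵗ ρ (a ⊗ b) = renᵗ ρ a ⊗ renᵗ ρ b
renᵗ ρ (a ⇒ b) = renᵗ ρ a ⇒ renᵗ ρ b
renᵗ ρ (μ a)   = μ (renᵗ (extᵗ ρ) a)
renᵗ ρ void    = void

extsᵗ : ∀ {k l} → (Fin k → TyExp l) → Fin (suc k) → TyExp (suc l)
extsᵗ s zero    = tv zero
extsᵗ s (suc i) = renᵗ suc (s i)

subᵗ : ∀ {k l} → (Fin k → TyExp l) → TyExp k → TyExp l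
subᵗ s (tv i)  = s i
subᵗ s (a ⊕ b) = subᵗ s a ⊕ subᵗ s b
subᵗ s (a ⊗ b) = subᵗ s a ⊗ subᵗ s b
subᵗ s (a ⇒ b) = subᵗ s a ⇒ subᵗ s b
subᵗ s (μ a)   = μ (subᵗ (extsᵗ s) a)
subᵗ s void    = void

_[_]ᵗ : ∀ {k} → TyExp (suc k) → TyExp k → TyExp k
σ [ τ ]ᵗ = subᵗ (λ { zero → τ ; (suc i) → tv i }) σ

-- Unf σ τ : unfolding the top-level μ's of σ (μt.σ ↦ σ[t:=μt.σ])
-- finitely often yields the type constructor τ (a +, ×, → or void node).
data Unf : Ty → Ty → Set where
  u⊕    : ∀ {a b} → Unf (a ⊕ b) (a ⊕ b)
  u⊗    : ∀ {a b} → Unf (a ⊗ b) (a ⊗ b)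
  u⇒    : ∀ {a b} → Unf (a ⇒ b) (a ⇒ b)
  uvoid : Unf void void
  uμ    : ∀ {a τ} → Unf (a [ μ a ]ᵗ) τ → Unf (μ a) τ

Diverges : Ty → Set
Diverges σ = ¬ (∃ λ τ → Unf σ τ)

-- EqN n σ τ : the infinite unfoldings (type trees) of σ and τ agree up to depth n
data EqN : ℕ → Ty → Ty → Set where
  eq0    : ∀ {σ τ} → EqN zero σ τ
  eq⊕    : ∀ {n σ τ a b c d} → Unf σ (a ⊕ b) → Unf τ (c ⊕ d) →
           EqN n a c → EqN n b d → EqN (suc n) σ τ
  eq⊗    : ∀ {n σ τ a b c d} → Unf σ (a ⊗ b) → Unf τ (c ⊗ d) →
           EqN n a c → EqN n b d → EqN (suc n) σ τ
  eq⇒    : ∀ {n σ τ a b c d} → Unf σ (a ⇒ b) → Unf τ (c ⇒ d) →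
           EqN n a c → EqN n b d → EqN (suc n) σ τ
  eqvoid : ∀ {n σ τ} → Unf σ void → Unf τ void → EqN (suc n) σ τ
  eqdiv  : ∀ {n σ τ} → Diverges σ → Diverges τ → EqN (suc n) σ τ

infix 4 _≃_
_≃_ : Ty → Ty → Set
σ ≃ τ = ∀ n → EqN n σ τ

data Const : Set where
  c0    : Ty → Ty → Const
  c1    : Ty → Ty → Const
  case  : Ty → Ty → Ty → Const
  pcase : Ty → Ty → Ty → Const
  pair  : Ty → Ty → Const
  fst   : Ty → Ty → Const
  snd   : Ty → Ty → Const
  Ω     : Ty → Const

constTy : Const → Ty
constTy (c0 σ τ)      = σ ⇒ (σ ⊕ τ)
constTy (c1 σ τ)      = τ ⇒ (σ ⊕ τ)
constTy (case σ τ ρ)  = (σ ⊕ τ) ⇒ (σ ⇒ ρ) ⇒ (τ ⇒ ρ) ⇒ ρ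
constTy (pcase σ τ ρ) = (σ ⊕ τ) ⇒ ρ ⇒ ρ ⇒ ρ
constTy (pair σ τ)    = σ ⇒ τ ⇒ (σ ⊗ τ)
constTy (fst σ τ)     = (σ ⊗ τ) ⇒ σ
constTy (snd σ τ)     = (σ ⊗ τ) ⇒ τ
constTy (Ω σ)         = σ

data _≅ᶜ_ : Const → Const → Set where
  c0≅    : ∀ {a b a' b'} → a ≃ a' → b ≃ b' → c0 a b ≅ᶜ c0 a' b'
  c1≅    : ∀ {a b a' b'} → a ≃ a' → b ≃ b' → c1 a b ≅ᶜ c1 a' b'
  case≅  : ∀ {a b c a' b' c'} → a ≃ a' → b ≃ b' → c ≃ c' → case a b c ≅ᶜ case a' b' c'
  pcase≅ : ∀ {a b c a' b' c'} → a ≃ a' → b ≃ b' → c ≃ c' → pcase a b c ≅ᶜ pcase a' b' c'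
  pair≅  : ∀ {a b a' b'} → a ≃ a' → b ≃ b' → pair a b ≅ᶜ pair a' b'
  fst≅   : ∀ {a b a' b'} → a ≃ a' → b ≃ b' → fst a b ≅ᶜ fst a' b'
  snd≅   : ∀ {a b a' b'} → a ≃ a' → b ≃ b' → snd a b ≅ᶜ snd a' b'
  Ω≅     : ∀ {a a'} → a ≃ a' → Ω a ≅ᶜ Ω a'

infixl 20 _·_

data Tm (n : ℕ) : Set where
  var : Fin n → Tm n
  ƛ   : Ty → Tm (suc n) → Tm n
  _·_ : Tm n → Tm n → Tm n
  con : Const → Tm n

Ctx : ℕ → Set
Ctx n = Vec Ty n

infix 3 _⊢_∶_
data _⊢_∶_ {n} (Γ : Ctx n) : Tm n → Ty → Set where
  ⊢var  : ∀ i → Γ ⊢ var i ∶ lookup Γ i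
  ⊢ƛ    : ∀ {ρ σ M} → (ρ ∷ Γ) ⊢ M ∶ σ → Γ ⊢ ƛ ρ M ∶ ρ ⇒ σ
  ⊢app  : ∀ {ρ σ M N} → Γ ⊢ M ∶ ρ ⇒ σ → Γ ⊢ N ∶ ρ → Γ ⊢ M · N ∶ σ
  ⊢con  : ∀ c → Γ ⊢ con c ∶ constTy c
  ⊢conv : ∀ {σ τ M} → Γ ⊢ M ∶ σ → σ ≃ τ → Γ ⊢ M ∶ τ

ext : ∀ {m n} → (Fin m → Fin n) → Fin (suc m) → Fin (suc n)
ext ρ zero    = zero
ext ρ (suc i) = suc (ρ i)

ren : ∀ {m n} → (Fin m → Fin n) → Tm m → Tm n
ren ρ (var i) = var (ρ i)
ren ρ (ƛ a M) = ƛ a (ren (ext ρ) M)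
ren ρ (M · N) = ren ρ M · ren ρ N
ren ρ (con c) = con c

exts : ∀ {m n} → (Fin m → Tm n) → Fin (suc m) → Tm (suc n)
exts s zero    = var zero
exts s (suc i) = ren suc (s i)

sub : ∀ {m n} → (Fin m → Tm n) → Tm m → Tm n
sub s (var i) = s i
sub s (ƛ a M) = ƛ a (sub (exts s) M)
sub s (M · N) = sub s M · sub s N
sub s (con c) = con c

_[_] : ∀ {n} → Tm (suc n) → Tm n → Tm n
M [ N ] = sub (λ { zero → N ; (suc i) → var i }) M

infix 4 _⟶_
data _⟶_ {n} : Tm n → Tm n → Set where
  β      : ∀ {a M N} → (ƛ a M) · N ⟶ M [ N ]
  case0  : ∀ {s t r a b x y z} →
           con (case s t r) · (con (c0 a b) · x) · y · z ⟶ y · x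
  case1  : ∀ {s t r a b x y z} →
           con (case s t r) · (con (c1 a b) · x) · y · z ⟶ z · x
  fstβ   : ∀ {s t a b x y} → con (fst s t) · (con (pair a b) · x · y) ⟶ x
  sndβ   : ∀ {s t a b x y} → con (snd s t) · (con (pair a b) · x · y) ⟶ y
  pcase0 : ∀ {s t r a b x y z} →
           con (pcase s t r) · (con (c0 a b) · x) · y · z ⟶ y
  pcase1 : ∀ {s t r a b x y z} →
           con (pcase s t r) · (con (c1 a b) · x) · y · z ⟶ z
  pc00   : ∀ {s t r a b a' b' x y z} →
           con (pcase s t r) · x · (con (c0 a b) · y) · (con (c0 a' b') · z)
             ⟶ con (c0 a b) · (con (pcase s t a) · x · y · z)
  pc11   : ∀ {s t r a b a' b' x y z} →
           con (pcase s t r) · x · (con (c1 a b) · y) · (con (c1 a' b') · z)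
             ⟶ con (c1 a b) · (con (pcase s t b) · x · y · z)
  pcpair : ∀ {s t r a b a' b' x y₁ y₂ z₁ z₂} →
           con (pcase s t r) · x · (con (pair a b) · y₁ · y₂) · (con (pair a' b') · z₁ · z₂)
             ⟶ con (pair a b) · (con (pcase s t a) · x · y₁ · z₁)
                              · (con (pcase s t b) · x · y₂ · z₂)
  pcapp  : ∀ {s t r p q x y z w} → Unf r (p ⇒ q) →
           (con (pcase s t r) · x · y · z) · w
             ⟶ con (pcase s t q) · x · (y · w) · (z · w)
  ξƛ     : ∀ {a M M'} → M ⟶ M' → ƛ a M ⟶ ƛ a M'
  ξl     : ∀ {M M' N} → M ⟶ M' → M · N ⟶ M' · N
  ξr     : ∀ {M N N'} → N ⟶ N' → M · N ⟶ M · N'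

infix 4 _⟶*_
_⟶*_ : ∀ {n} → Tm n → Tm n → Set
_⟶*_ = Star _⟶_

Normal : ∀ {n} → Tm n → Set
Normal M = ∀ N → ¬ (M ⟶ N)

infix 3 _⊢_⪯_∶_
data _⊢_⪯_∶_ {n} (Γ : Ctx n) : Tm n → Tm n → Ty → Set where
  Ω⪯    : ∀ {σ M} → Γ ⊢ M ∶ σ → Γ ⊢ con (Ω σ) ⪯ M ∶ σ
  var⪯  : ∀ i → Γ ⊢ var i ⪯ var i ∶ lookup Γ i
  con⪯  : ∀ {c c'} → c ≅ᶜ c' → Γ ⊢ con c ⪯ con c' ∶ constTy c
  ƛ⪯    : ∀ {ρ ρ' σ A M} → ρ ≃ ρ' → (ρ ∷ Γ) ⊢ A ⪯ M ∶ σ → Γ ⊢ ƛ ρ A ⪯ ƛ ρ' M ∶ ρ ⇒ σ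
  app⪯  : ∀ {ρ σ A₁ A₂ M₁ M₂} → Γ ⊢ A₁ ⪯ M₁ ∶ ρ ⇒ σ → Γ ⊢ A₂ ⪯ M₂ ∶ ρ →
          Γ ⊢ A₁ · A₂ ⪯ M₁ · M₂ ∶ σ
  conv⪯ : ∀ {σ τ A M} → Γ ⊢ A ⪯ M ∶ σ → σ ≃ τ → Γ ⊢ A ⪯ M ∶ τ

IsΩ : ∀ {n} → Tm n → Set
IsΩ A = ∃ λ σ → A ≡ con (Ω σ)

data AllowedHead : Const → Set where
  h0    : ∀ {a b} → AllowedHead (c0 a b)
  h1    : ∀ {a b} → AllowedHead (c1 a b)
  hcase : ∀ {a b c} → AllowedHead (case a b c)
  hpair : ∀ {a b} → AllowedHead (pair a b)
  hfst  : ∀ {a b} → AllowedHead (fst a b)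
  hsnd  : ∀ {a b} → AllowedHead (snd a b)

data Destructor : Const → Set where
  dcase : ∀ {a b c} → Destructor (case a b c)
  dfst  : ∀ {a b} → Destructor (fst a b)
  dsnd  : ∀ {a b} → Destructor (snd a b)

FirstArgOK : ∀ {n} → Tm n → Tm n → Set
FirstArgOK (con c) A = Destructor c → ¬ IsΩ A
FirstArgOK _       A = ⊤

mutual
  -- A = Ω  or  A = λx₁…xₙ. y A₁ … Aₘ
  data CShape {n} : Tm n → Set where
    sΩ   : ∀ {σ} → CShape (con (Ω σ))
    sLam : ∀ {A} → LamSpine A → CShape A

  data LamSpine {n} : Tm n → Set where
    lƛ  : ∀ {ρ A} → LamSpine A → LamSpine (ƛ ρ A)
    lsp : ∀ {A} → Spine A → LamSpine A

  data Spine {n} : Tm n → Set where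
    svar : ∀ i → Spine (var i)
    scon : ∀ {c} → AllowedHead c → Spine (con c)
    sapp : ∀ {M A} → Spine M → CShape A → FirstArgOK M A → Spine (M · A)

ConstantNormalForm : ∀ {n} → Tm n → Set
ConstantNormalForm A = Normal A × CShape A

DirectApprox : ∀ {n} → Ctx n → Ty → Tm n → Tm n → Set
DirectApprox Γ σ A M = ∀ N → M ⟶* N → Γ ⊢ A ⪯ N ∶ σ

module Submission where

-- It suffices to show that one reduction step M ⟶ N preserves Γ ⊢ A ⪯ M ∶ σ
-- (then induct on M ⟶* N).  By induction on the prefix derivation:
--  * where A is Ω, the step happens inside the part of M that A does not
--    constrain; Ω ⪯ N only needs N to be typable, which is subject reduction;
--  * a congruence step lands in the subterm of M approximated by a subterm of
--    A, which is again of constant shape and normal, so induction applies;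
--  * a step at the root of an approximated application is impossible: A is a
--    spine y A₁ … Aₘ, so M cannot be a β-redex (its head is no λ), nor a pcase
--    redex (pcase is not an admissible head), and a case/fst/snd redex of M is
--    already visible in A (the first argument of a destructor is not Ω),
--    contradicting normality of A.

open import Data.Nat using (ℕ; suc)
open import Data.Fin using (Fin; zero; suc)
open import Data.Vec using (_∷_; lookup)
open import Data.Product using (∃; _×_; _,_; proj₁; proj₂)
open import Data.Sum using (_⊎_; inj₁; inj₂)
open import Data.Empty using (⊥-elim)
open import Relation.Nullary using (¬_)
open import Relation.Binary.PropositionalEquality using (_≡_; refl; subst)
open import Relation.Binary.Construct.Closure.ReflexiveTransitive using (ε; _◅_)
open import Defs

private
  variable
    n : ℕ
    Γ : Ctx n
    a b c d r r' s t σ τ X Y : Ty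
    A A₁ A₂ M M₁ M₂ N x y z : Tm n


unf-det : Unf σ X → Unf σ Y → X ≡ Y
unf-det u⊕       u⊕       = refl
unf-det u⊗       u⊗       = refl
unf-det u⇒       u⇒       = refl
unf-det uvoid    uvoid    = refl
unf-det (uμ u)   (uμ v)   = unf-det u v

data Match (k : ℕ) : Ty → Ty → Set where
  m⊕    : EqN k a c → EqN k b d → Match k (a ⊕ b) (c ⊕ d)
  m⊗    : EqN k a c → EqN k b d → Match k (a ⊗ b) (c ⊗ d)
  m⇒    : EqN k a c → EqN k b d → Match k (a ⇒ b) (c ⇒ d)
  mvoid : Match k void void

eqN-unf : ∀ {k} → EqN (suc k) σ τ → Unf σ X → ∃ λ Y → Unf τ Y × Match k X Y
eqN-unf (eq⊕ u v e e') u' with unf-det u u'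
... | refl = _ , v , m⊕ e e'
eqN-unf (eq⊗ u v e e') u' with unf-det u u'
... | refl = _ , v , m⊗ e e'
eqN-unf (eq⇒ u v e e') u' with unf-det u u'
... | refl = _ , v , m⇒ e e'
eqN-unf (eqvoid u v) u' with unf-det u u'
... | refl = _ , v , mvoid
eqN-unf (eqdiv div _) u' = ⊥-elim (div (_ , u'))

eqN-children : ∀ {k} → EqN (suc k) σ τ → Unf σ X → Unf τ Y → Match k X Y
eqN-children e u v with eqN-unf e u
... | _ , v' , m with unf-det v v'
... | refl = m

eqN-sym : ∀ {k} → EqN k σ τ → EqN k τ σ
eqN-sym eq0             = eq0
eqN-sym (eq⊕ u v e e')  = eq⊕ v u (eqN-sym e) (eqN-sym e')
eqN-sym (eq⊗ u v e e')  = eq⊗ v u (eqN-sym e) (eqN-sym e')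
eqN-sym (eq⇒ u v e e')  = eq⇒ v u (eqN-sym e) (eqN-sym e')
eqN-sym (eqvoid u v)    = eqvoid v u
eqN-sym (eqdiv div div') = eqdiv div' div

eqN-diverges : ∀ {k} → EqN (suc k) σ τ → Diverges σ → Diverges τ
eqN-diverges e div (_ , v) with eqN-unf (eqN-sym e) v
... | _ , u , _ = div (_ , u)

eqN-trans : ∀ {k υ} → EqN k σ τ → EqN k τ υ → EqN k σ υ
eqN-trans eq0 _ = eq0
eqN-trans (eq⊕ u v e₁ e₂) e with eqN-unf e v
... | _ , w , m⊕ e₁' e₂' = eq⊕ u w (eqN-trans e₁ e₁') (eqN-trans e₂ e₂')
eqN-trans (eq⊗ u v e₁ e₂) e with eqN-unf e v
... | _ , w , m⊗ e₁' e₂' = eq⊗ u w (eqN-trans e₁ e₁') (eqN-trans e₂ e₂')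
eqN-trans (eq⇒ u v e₁ e₂) e with eqN-unf e v
... | _ , w , m⇒ e₁' e₂' = eq⇒ u w (eqN-trans e₁ e₁') (eqN-trans e₂ e₂')
eqN-trans (eqvoid u v) e with eqN-unf e v
... | _ , w , mvoid = eqvoid u w
eqN-trans (eqdiv div div') e = eqdiv div (eqN-diverges e div')

-- Type equality as used by typing: ≃, with syntactic identity adjoined
-- because reflexivity of ≃ would require deciding divergence of a type.
infix 4 _∼_
_∼_ : Ty → Ty → Set
σ ∼ τ = σ ≡ τ ⊎ σ ≃ τ

∼-sym : σ ∼ τ → τ ∼ σ
∼-sym (inj₁ refl) = inj₁ refl
∼-sym (inj₂ e)    = inj₂ (λ k → eqN-sym (e k))

∼-trans : ∀ {υ} → σ ∼ τ → τ ∼ υ → σ ∼ υ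
∼-trans (inj₁ refl) e'          = e'
∼-trans (inj₂ e)    (inj₁ refl) = inj₂ e
∼-trans (inj₂ e)    (inj₂ e')   = inj₂ (λ k → eqN-trans (e k) (e' k))

match-⇒ : ∀ {k} → Match k (a ⇒ b) (c ⇒ d) → EqN k a c × EqN k b d
match-⇒ (m⇒ e₁ e₂) = e₁ , e₂

match-⊕ : ∀ {k} → Match k (a ⊕ b) (c ⊕ d) → EqN k a c × EqN k b d
match-⊕ (m⊕ e₁ e₂) = e₁ , e₂

match-⊗ : ∀ {k} → Match k (a ⊗ b) (c ⊗ d) → EqN k a c × EqN k b d
match-⊗ (m⊗ e₁ e₂) = e₁ , e₂

∼-⇒ : Unf r (a ⇒ b) → Unf r' (c ⇒ d) → r ∼ r' → a ∼ c × b ∼ d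
∼-⇒ u v (inj₁ refl) with unf-det u v
... | refl = inj₁ refl , inj₁ refl
∼-⇒ u v (inj₂ e) =
  inj₂ (λ k → proj₁ (match-⇒ (eqN-children (e (suc k)) u v))) ,
  inj₂ (λ k → proj₂ (match-⇒ (eqN-children (e (suc k)) u v)))

∼-⊕ : (a ⊕ b) ∼ (c ⊕ d) → a ∼ c × b ∼ d
∼-⊕ (inj₁ refl) = inj₁ refl , inj₁ refl
∼-⊕ (inj₂ e) =
  inj₂ (λ k → proj₁ (match-⊕ (eqN-children (e (suc k)) u⊕ u⊕))) ,
  inj₂ (λ k → proj₂ (match-⊕ (eqN-children (e (suc k)) u⊕ u⊕)))

∼-⊗ : (a ⊗ b) ∼ (c ⊗ d) → a ∼ c × b ∼ d
∼-⊗ (inj₁ refl) = inj₁ refl , inj₁ refl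
∼-⊗ (inj₂ e) =
  inj₂ (λ k → proj₁ (match-⊗ (eqN-children (e (suc k)) u⊗ u⊗))) ,
  inj₂ (λ k → proj₂ (match-⊗ (eqN-children (e (suc k)) u⊗ u⊗)))

conv : σ ∼ τ → Γ ⊢ M ∶ σ → Γ ⊢ M ∶ τ
conv (inj₁ refl) dM = dM
conv (inj₂ e)    dM = ⊢conv dM e

inv-ƛ : Γ ⊢ ƛ r M ∶ τ → ∃ λ σ → ((r ∷ Γ) ⊢ M ∶ σ) × (r ⇒ σ) ∼ τ
inv-ƛ (⊢ƛ dM) = _ , dM , inj₁ refl
inv-ƛ (⊢conv dM e) = let σ , dM' , e' = inv-ƛ dM in σ , dM' , ∼-trans e' (inj₂ e)

inv-· : Γ ⊢ M · N ∶ τ → ∃ λ r → ∃ λ σ → (Γ ⊢ M ∶ r ⇒ σ) × (Γ ⊢ N ∶ r) × σ ∼ τ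
inv-· (⊢app dM dN) = _ , _ , dM , dN , inj₁ refl
inv-· (⊢conv dMN e) =
  let r , σ , dM , dN , e' = inv-· dMN in r , σ , dM , dN , ∼-trans e' (inj₂ e)

Principal : Ctx n → Tm n → Ty → Set
Principal Γ F T = ∀ {τ} → Γ ⊢ F ∶ τ → T ∼ τ

principal-con : ∀ k → Principal Γ (con k) (constTy k)
principal-con k (⊢con .k)    = inj₁ refl
principal-con k (⊢conv dk e) = ∼-trans (principal-con k dk) (inj₂ e)

inv-principal-· : Principal Γ M (a ⇒ b) → Γ ⊢ M · N ∶ τ →
  (Γ ⊢ M ∶ a ⇒ b) × (Γ ⊢ N ∶ a) × b ∼ τ
inv-principal-· pM dMN =
  let _ , _ , dM , dN , e = inv-· dMN
      e' = pM dM
      ea , eb = ∼-⇒ u⇒ u⇒ e'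
  in conv (∼-sym e') dM , conv (∼-sym ea) dN , ∼-trans eb e

principal-· : Principal Γ M (a ⇒ b) → Principal Γ (M · N) b
principal-· pM dMN = proj₂ (proj₂ (inv-principal-· pM dMN))

inv-c0 : Γ ⊢ con (c0 a b) · x ∶ τ → (Γ ⊢ x ∶ a) × (a ⊕ b) ∼ τ
inv-c0 dM = proj₂ (inv-principal-· (principal-con (c0 _ _)) dM)

inv-c1 : Γ ⊢ con (c1 a b) · x ∶ τ → (Γ ⊢ x ∶ b) × (a ⊕ b) ∼ τ
inv-c1 dM = proj₂ (inv-principal-· (principal-con (c1 _ _)) dM)

inv-fst : Γ ⊢ con (fst s t) · x ∶ τ → (Γ ⊢ x ∶ s ⊗ t) × s ∼ τ
inv-fst dM = proj₂ (inv-principal-· (principal-con (fst _ _)) dM)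

inv-snd : Γ ⊢ con (snd s t) · x ∶ τ → (Γ ⊢ x ∶ s ⊗ t) × t ∼ τ
inv-snd dM = proj₂ (inv-principal-· (principal-con (snd _ _)) dM)

inv-pair : Γ ⊢ con (pair a b) · x · y ∶ τ → (Γ ⊢ x ∶ a) × (Γ ⊢ y ∶ b) × (a ⊗ b) ∼ τ
inv-pair dM =
  let dpx , dy , e = inv-principal-· (principal-· (principal-con (pair _ _))) dM
      _ , dx , _ = inv-principal-· (principal-con (pair _ _)) dpx
  in dx , dy , e

inv-case : Γ ⊢ con (case s t r) · x · y · z ∶ τ →
  (Γ ⊢ x ∶ s ⊕ t) × (Γ ⊢ y ∶ s ⇒ r) × (Γ ⊢ z ∶ t ⇒ r) × r ∼ τ
inv-case dM =
  let dcxy , dz , e = inv-principal-· (principal-· (principal-· (principal-con (case _ _ _)))) dM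
      dcx , dy , _ = inv-principal-· (principal-· (principal-con (case _ _ _))) dcxy
      _ , dx , _ = inv-principal-· (principal-con (case _ _ _)) dcx
  in dx , dy , dz , e

inv-pcase : Γ ⊢ con (pcase s t r) · x · y · z ∶ τ →
  (Γ ⊢ x ∶ s ⊕ t) × (Γ ⊢ y ∶ r) × (Γ ⊢ z ∶ r) × r ∼ τ
inv-pcase dM =
  let dcxy , dz , e = inv-principal-· (principal-· (principal-· (principal-con (pcase _ _ _)))) dM
      dcx , dy , _ = inv-principal-· (principal-· (principal-con (pcase _ _ _))) dcxy
      _ , dx , _ = inv-principal-· (principal-con (pcase _ _ _)) dcx
  in dx , dy , dz , e

ren-ty : ∀ {m} {Δ : Ctx m} (ρ : Fin n → Fin m) → (∀ i → lookup Δ (ρ i) ≡ lookup Γ i) →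
  Γ ⊢ M ∶ σ → Δ ⊢ ren ρ M ∶ σ
ren-ty {Δ = Δ} ρ h (⊢var i) = subst (Δ ⊢ var (ρ i) ∶_) (h i) (⊢var (ρ i))
ren-ty ρ h (⊢ƛ dM) = ⊢ƛ (ren-ty (ext ρ) (λ { zero → refl ; (suc i) → h i }) dM)
ren-ty ρ h (⊢app dM dN) = ⊢app (ren-ty ρ h dM) (ren-ty ρ h dN)
ren-ty ρ h (⊢con k) = ⊢con k
ren-ty ρ h (⊢conv dM e) = ⊢conv (ren-ty ρ h dM) e

sub-ty : ∀ {m} {Δ : Ctx m} (θ : Fin n → Tm m) → (∀ i → Δ ⊢ θ i ∶ lookup Γ i) →
  Γ ⊢ M ∶ σ → Δ ⊢ sub θ M ∶ σ
sub-ty θ h (⊢var i) = h i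
sub-ty θ h (⊢ƛ dM) =
  ⊢ƛ (sub-ty (exts θ) (λ { zero → ⊢var zero ; (suc i) → ren-ty suc (λ _ → refl) (h i) }) dM)
sub-ty θ h (⊢app dM dN) = ⊢app (sub-ty θ h dM) (sub-ty θ h dN)
sub-ty θ h (⊢con k) = ⊢con k
sub-ty θ h (⊢conv dM e) = ⊢conv (sub-ty θ h dM) e

sub1-ty : (r ∷ Γ) ⊢ M ∶ σ → Γ ⊢ N ∶ r → Γ ⊢ M [ N ] ∶ σ
sub1-ty dM dN = sub-ty _ (λ { zero → dN ; (suc i) → ⊢var i }) dM

-- The pcase rules that push pcase under a constructor or an argument
-- preserve types: both branches have the pcase result type, so after
-- decomposition their components have equal types.
pc00-ty : ∀ {a' b'} →
  Γ ⊢ con (pcase s t r) · x · (con (c0 a b) · y) · (con (c0 a' b') · z) ∶ τ →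
  Γ ⊢ con (c0 a b) · (con (pcase s t a) · x · y · z) ∶ τ
pc00-ty dM =
  let dx , dy₀ , dz₀ , e = inv-pcase dM
      dy , ey = inv-c0 dy₀
      dz , ez = inv-c0 dz₀
  in conv (∼-trans ey e) (⊢app (⊢con _)
       (⊢app (⊢app (⊢app (⊢con _) dx) dy) (conv (proj₁ (∼-⊕ (∼-trans ez (∼-sym ey)))) dz)))

pc11-ty : ∀ {a' b'} →
  Γ ⊢ con (pcase s t r) · x · (con (c1 a b) · y) · (con (c1 a' b') · z) ∶ τ →
  Γ ⊢ con (c1 a b) · (con (pcase s t b) · x · y · z) ∶ τ
pc11-ty dM =
  let dx , dy₁ , dz₁ , e = inv-pcase dM
      dy , ey = inv-c1 dy₁
      dz , ez = inv-c1 dz₁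
  in conv (∼-trans ey e) (⊢app (⊢con _)
       (⊢app (⊢app (⊢app (⊢con _) dx) dy) (conv (proj₂ (∼-⊕ (∼-trans ez (∼-sym ey)))) dz)))

pcpair-ty : ∀ {a' b' y₁ y₂ z₁ z₂} →
  Γ ⊢ con (pcase s t r) · x · (con (pair a b) · y₁ · y₂) · (con (pair a' b') · z₁ · z₂) ∶ τ →
  Γ ⊢ con (pair a b) · (con (pcase s t a) · x · y₁ · z₁) · (con (pcase s t b) · x · y₂ · z₂) ∶ τ
pcpair-ty dM =
  let dx , dyp , dzp , e = inv-pcase dM
      dy₁ , dy₂ , ey = inv-pair dyp
      dz₁ , dz₂ , ez = inv-pair dzp
      e₁ , e₂ = ∼-⊗ (∼-trans ez (∼-sym ey))
  in conv (∼-trans ey e) (⊢app (⊢app (⊢con _)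
       (⊢app (⊢app (⊢app (⊢con _) dx) dy₁) (conv e₁ dz₁)))
       (⊢app (⊢app (⊢app (⊢con _) dx) dy₂) (conv e₂ dz₂)))

pcapp-ty : ∀ {w} → Unf r (a ⇒ b) →
  Γ ⊢ con (pcase s t r) · x · y · z · w ∶ τ →
  Γ ⊢ con (pcase s t b) · x · (y · w) · (z · w) ∶ τ
pcapp-ty u dM =
  let _ , _ , dP , dw , e = inv-· dM
      dx , dy , dz , er = inv-pcase dP
      _ , eb = ∼-⇒ u u⇒ er
  in conv (∼-trans eb e) (⊢app (⊢app (⊢app (⊢con _) dx)
       (conv (∼-sym eb) (⊢app (conv er dy) dw)))
       (conv (∼-sym eb) (⊢app (conv er dz) dw)))

subject-reduction : Γ ⊢ M ∶ τ → M ⟶ N → Γ ⊢ N ∶ τ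
subject-reduction dM β =
  let _ , _ , dF , dN , e = inv-· dM
      _ , dB , e' = inv-ƛ dF
      ea , eb = ∼-⇒ u⇒ u⇒ e'
  in conv (∼-trans eb e) (sub1-ty dB (conv (∼-sym ea) dN))
subject-reduction dM case0 =
  let dx₀ , dy , _ , e = inv-case dM
      dx , e₀ = inv-c0 dx₀
  in conv e (⊢app dy (conv (proj₁ (∼-⊕ e₀)) dx))
subject-reduction dM case1 =
  let dx₁ , _ , dz , e = inv-case dM
      dx , e₁ = inv-c1 dx₁
  in conv e (⊢app dz (conv (proj₂ (∼-⊕ e₁)) dx))
subject-reduction dM fstβ =
  let dp , e = inv-fst dM
      dx , _ , eₚ = inv-pair dp
  in conv (∼-trans (proj₁ (∼-⊗ eₚ)) e) dx
subject-reduction dM sndβ =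
  let dp , e = inv-snd dM
      _ , dy , eₚ = inv-pair dp
  in conv (∼-trans (proj₂ (∼-⊗ eₚ)) e) dy
subject-reduction dM pcase0 = let _ , dy , _ , e = inv-pcase dM in conv e dy
subject-reduction dM pcase1 = let _ , _ , dz , e = inv-pcase dM in conv e dz
subject-reduction dM pc00      = pc00-ty dM
subject-reduction dM pc11      = pc11-ty dM
subject-reduction dM pcpair    = pcpair-ty dM
subject-reduction dM (pcapp u) = pcapp-ty u dM
subject-reduction dM (ξƛ r) =
  let _ , dB , e = inv-ƛ dM in conv e (⊢ƛ (subject-reduction dB r))
subject-reduction dM (ξl r) =
  let _ , _ , dF , dN , e = inv-· dM in conv e (⊢app (subject-reduction dF r) dN)
subject-reduction dM (ξr r) =
  let _ , _ , dF , dN , e = inv-· dM in conv e (⊢app dF (subject-reduction dN r))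


-- A ⊑ M: the prefix relation with typing forgotten; it records the shape of
-- M that a prefix A forces, which is all the redex analysis needs.
infix 4 _⊑_
data _⊑_ {n} : Tm n → Tm n → Set where
  Ω⊑   : ∀ {σ M} → con (Ω σ) ⊑ M
  var⊑ : ∀ i → var i ⊑ var i
  con⊑ : ∀ {k k'} → k ≅ᶜ k' → con k ⊑ con k'
  ƛ⊑   : ∀ {ρ ρ'} {A M : Tm (suc n)} → A ⊑ M → ƛ ρ A ⊑ ƛ ρ' M
  ·⊑   : ∀ {A₁ A₂ M₁ M₂} → A₁ ⊑ M₁ → A₂ ⊑ M₂ → A₁ · A₂ ⊑ M₁ · M₂

skeleton : Γ ⊢ A ⪯ M ∶ σ → A ⊑ M
skeleton (Ω⪯ _)       = Ω⊑
skeleton (var⪯ i)     = var⊑ i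
skeleton (con⪯ e)     = con⊑ e
skeleton (ƛ⪯ _ p)     = ƛ⊑ (skeleton p)
skeleton (app⪯ p₁ p₂) = ·⊑ (skeleton p₁) (skeleton p₂)
skeleton (conv⪯ p _)  = skeleton p


data SpineApp {n} : Tm n → Tm n → Tm n → Set where
  split : Spine A₁ → CShape A₂ → FirstArgOK A₁ A₂ → A₁ ⊑ M₁ → A₂ ⊑ M₂ →
          SpineApp (A₁ · A₂) M₁ M₂

spine-· : Spine A → A ⊑ M₁ · M₂ → SpineApp A M₁ M₂
spine-· (scon ())       Ω⊑
spine-· (sapp sp cs ok) (·⊑ sh₁ sh₂) = split sp cs ok sh₁ sh₂

data SpineCon {n} : Tm n → Const → Set where
  head : ∀ {k k'} → k' ≅ᶜ k → SpineCon (con k') k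

spine-con : ∀ {k} → Spine A → A ⊑ con k → SpineCon A k
spine-con (scon ()) Ω⊑
spine-con (scon _)  (con⊑ e) = head e

≅ᶜ-destructor : ∀ {k k'} → k ≅ᶜ k' → Destructor k' → Destructor k
≅ᶜ-destructor (case≅ _ _ _) dcase = dcase
≅ᶜ-destructor (fst≅ _ _)    dfst  = dfst
≅ᶜ-destructor (snd≅ _ _)    dsnd  = dsnd

-- A spine approximating a destructor applied to an application: the first
-- argument of the destructor is not Ω, so it is again a spine.
data DestructorApp {n} : Tm n → Const → Tm n → Set where
  dapp : ∀ {k k'} → k' ≅ᶜ k → Spine A₁ → A₁ ⊑ M₁ · M₂ →
         DestructorApp (con k' · A₁) k (M₁ · M₂)

destructor-app : ∀ {k} → Destructor k → Spine A → A ⊑ con k · (M₁ · M₂) →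
  DestructorApp A k (M₁ · M₂)
destructor-app dk sp sh with spine-· sp sh
... | split sp₀ cs ok sh₀ sh₁ with spine-con sp₀ sh₀
... | head e = dapp e (argument-spine cs (ok (≅ᶜ-destructor e dk)) sh₁) sh₁
  where
    argument-spine : CShape A₁ → ¬ IsΩ A₁ → A₁ ⊑ M₁ · M₂ → Spine A₁
    argument-spine sΩ               notΩ _ = ⊥-elim (notΩ (_ , refl))
    argument-spine (sLam (lƛ _))    _    ()
    argument-spine (sLam (lsp sp₁)) _    _ = sp₁


spine-not-ƛ : ∀ {ρ} {B : Tm (suc n)} → Spine A → ¬ (A ⊑ ƛ ρ B)
spine-not-ƛ (scon ()) Ω⊑

data PcaseHeaded {n} : Tm n → Set where
  pc-head : PcaseHeaded (con (pcase s t r))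
  pc-arg  : PcaseHeaded M → PcaseHeaded (M · N)

pcase₃ : PcaseHeaded (con (pcase s t r) · x · y · z)
pcase₃ = pc-arg (pc-arg (pc-arg pc-head))

spine-not-pcase : Spine A → A ⊑ M → ¬ PcaseHeaded M
spine-not-pcase (scon ())     Ω⊑                    _
spine-not-pcase (scon ())     (con⊑ (pcase≅ _ _ _)) pc-head
spine-not-pcase (sapp sp _ _) (·⊑ sh _)             (pc-arg h) = spine-not-pcase sp sh h

case0-reflected : ∀ {a b} → Spine A →
  A ⊑ con (case s t r) · (con (c0 a b) · x) · y · z → ∃ λ A' → A ⟶ A'
case0-reflected sp sh with spine-· sp sh
... | split sp₁ _ _ sh₁ _ with spine-· sp₁ sh₁
... | split sp₂ _ _ sh₂ _ with destructor-app dcase sp₂ sh₂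
... | dapp (case≅ _ _ _) spx shx with spine-· spx shx
... | split spi _ _ shi _ with spine-con spi shi
... | head (c0≅ _ _) = _ , case0

case1-reflected : ∀ {a b} → Spine A →
  A ⊑ con (case s t r) · (con (c1 a b) · x) · y · z → ∃ λ A' → A ⟶ A'
case1-reflected sp sh with spine-· sp sh
... | split sp₁ _ _ sh₁ _ with spine-· sp₁ sh₁
... | split sp₂ _ _ sh₂ _ with destructor-app dcase sp₂ sh₂
... | dapp (case≅ _ _ _) spx shx with spine-· spx shx
... | split spi _ _ shi _ with spine-con spi shi
... | head (c1≅ _ _) = _ , case1

fst-reflected : ∀ {a b} → Spine A →
  A ⊑ con (fst s t) · (con (pair a b) · x · y) → ∃ λ A' → A ⟶ A'
fst-reflected sp sh with destructor-app dfst sp sh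
... | dapp (fst≅ _ _) spp shp with spine-· spp shp
... | split spx _ _ shx _ with spine-· spx shx
... | split spi _ _ shi _ with spine-con spi shi
... | head (pair≅ _ _) = _ , fstβ

snd-reflected : ∀ {a b} → Spine A →
  A ⊑ con (snd s t) · (con (pair a b) · x · y) → ∃ λ A' → A ⟶ A'
snd-reflected sp sh with destructor-app dsnd sp sh
... | dapp (snd≅ _ _) spp shp with spine-· spp shp
... | split spx _ _ shx _ with spine-· spx shx
... | split spi _ _ shi _ with spine-con spi shi
... | head (pair≅ _ _) = _ , sndβ


normal-ƛ : ∀ {ρ} {B : Tm (suc n)} → Normal (ƛ ρ B) → Normal B
normal-ƛ nf _ r = nf _ (ξƛ r)

normal-·ˡ : Normal (A₁ · A₂) → Normal A₁
normal-·ˡ nf _ r = nf _ (ξl r)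

normal-·ʳ : Normal (A₁ · A₂) → Normal A₂
normal-·ʳ nf _ r = nf _ (ξr r)

step : CShape A → Normal A → Γ ⊢ A ⪯ M ∶ σ → M ⟶ N → Γ ⊢ A ⪯ N ∶ σ
step _ _ (Ω⪯ dM) r = Ω⪯ (subject-reduction dM r)
step _ _ (var⪯ _) ()
step _ _ (con⪯ _) ()
step (sLam (lƛ l)) nf (ƛ⪯ e p) (ξƛ r) = ƛ⪯ e (step (sLam l) (normal-ƛ nf) p r)
step cs nf (conv⪯ p e) r = conv⪯ (step cs nf p r) e
step {A = A₁ · A₂} {Γ = Γ} {M = M₁ · M₂} {σ = σ} (sLam (lsp spA@(sapp sp cs _))) nf
     (app⪯ p₁ p₂) r = app-step r
  where
    sh : A₁ · A₂ ⊑ M₁ · M₂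
    sh = skeleton (app⪯ p₁ p₂)

    app-step : ∀ {N} → M₁ · M₂ ⟶ N → Γ ⊢ A₁ · A₂ ⪯ N ∶ σ
    app-step β         = ⊥-elim (spine-not-ƛ sp (skeleton p₁))
    app-step case0     = ⊥-elim (nf _ (proj₂ (case0-reflected spA sh)))
    app-step case1     = ⊥-elim (nf _ (proj₂ (case1-reflected spA sh)))
    app-step fstβ      = ⊥-elim (nf _ (proj₂ (fst-reflected spA sh)))
    app-step sndβ      = ⊥-elim (nf _ (proj₂ (snd-reflected spA sh)))
    app-step pcase0    = ⊥-elim (spine-not-pcase spA sh pcase₃)
    app-step pcase1    = ⊥-elim (spine-not-pcase spA sh pcase₃)
    app-step pc00      = ⊥-elim (spine-not-pcase spA sh pcase₃)
    app-step pc11      = ⊥-elim (spine-not-pcase spA sh pcase₃)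
    app-step pcpair    = ⊥-elim (spine-not-pcase spA sh pcase₃)
    app-step (pcapp _) = ⊥-elim (spine-not-pcase spA sh (pc-arg pcase₃))
    app-step (ξl r')   = app⪯ (step (sLam (lsp sp)) (normal-·ˡ nf) p₁ r') p₂
    app-step (ξr r')   = app⪯ p₁ (step cs (normal-·ʳ nf) p₂ r')

step* : CShape A → Normal A → Γ ⊢ A ⪯ M ∶ σ → M ⟶* N → Γ ⊢ A ⪯ N ∶ σ
step* _  _  p ε        = p
step* cs nf p (r ◅ rs) = step* cs nf (step cs nf p r) rs

mainTheorem13 : ∀ {n} (Γ : Ctx n) (σ : Ty) (A M : Tm n) →
    ConstantNormalForm A → Γ ⊢ A ⪯ M ∶ σ → DirectApprox Γ σ A M
mainTheorem13 Γ σ A M (nf , cs) p N rs = step* cs nf p rs
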